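{- The HardMHV problem can be approximated within a factor of $\Omega(\Delta^{ -3})$ in polynomial time, where $\Delta$ is the maximum degree of vertices in the input graph. That is, there exist an absolute constant $\alpha>0$ and a polynomial-time algorithm which, on every HardMHV instance whose graph has maximum degree $\Delta\ge1$, outputs a total vertex coloring extending the given partial coloring whose number of happy vertices is at least $\alpha\,\Delta^{ -3}\cdot OPT$, where $OPT$ is the maximum number of happy vertices over all total colorings extending the given partial coloring.
   Context: HardMHV problem (Maximum Happy Vertices with hard threshold): an instance consists of a connected undirected graph $G=(V,E)$, a color set $C=\{1,2,\ldots,k\}$, a partial vertex coloring $c\colon V\to C$ (i.e. $c$ assigns colors to only part of the vertices), and an integer $q>0$, where it is assumed that $q\le\Delta$ with $\Delta$ the maximum degree of $G$. Under a total coloring $c'\colon V\to C$, a vertex $v$ is happy if at least $q$ of its neighbors have the same color as $v$. The task is to find a total coloring extending $c$ (agreeing with $c$ wherever $c$ is defined) that maximizes the number of happy vertices. -}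

module Defs where

open import Data.Bool.Base using (Bool; true; false; if_then_else_; _∧_; T)
open import Data.Fin.Base using (Fin; toℕ; fromℕ<)
import Data.Fin.Properties as Fin
open import Data.Fin.Subset using (Subset; ∣_∣)
open import Data.List.Base
  using (List; []; _∷_; _++_; map; allFin; filter; concatMap; cartesianProductWith)
open import Data.List.Extrema.Nat using (max; xs≤max; argmax-sel)
open import Data.List.Membership.Propositional using (_∈_)
import Data.List.Membership.Propositional.Properties as Mem
open import Data.List.Relation.Unary.Any using (here)
import Data.List.Relation.Unary.All as All
open import Data.Maybe.Base using (Maybe; just; nothing; maybe′)
import Data.Maybe.Relation.Unary.All as Maybe
open import Data.Nat.Base using (ℕ; zero; suc; _+_; _*_; _∸_; _^_; _≤_; _<_; NonZero)
open import Data.Nat.ListAction using (sum)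
open import Data.Nat.Logarithm using (⌊log₂_⌋)
import Data.Nat.Properties as ℕ
open import Data.Product.Base using (∃-syntax; _×_; _,_)
open import Data.Sum.Base using (inj₁; inj₂)
open import Data.Vec.Base as Vec using (Vec; []; _∷_; lookup; tabulate)
open import Data.Vec.Properties using (lookup∘tabulate)
open import Function.Base using (id; _∘_)
open import Relation.Binary.Construct.Closure.ReflexiveTransitive using (Star)
open import Relation.Binary.PropositionalEquality
  using (_≡_; _≢_; refl; sym; trans; subst)
open import Relation.Nullary.Decidable using (does)
open import Relation.Unary using (Decidable)

------------------------------------------------------------------------
-- Graphs

record Graph (n : ℕ) : Set where
  field
    adj       : Fin n → Fin n → Bool
    symmetric : ∀ u v → adj u v ≡ adj v u
    loopless  : ∀ v → adj v v ≡ false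

  _~_ : Fin n → Fin n → Set
  u ~ v = T (adj u v)

  Connected : Set
  Connected = ∀ u v → Star _~_ u v

  neighbours : Fin n → Subset n
  neighbours v = tabulate (adj v)

  degree : Fin n → ℕ
  degree v = ∣ neighbours v ∣

  maxDegree : ℕ
  maxDegree = max 0 (map degree (allFin n))

------------------------------------------------------------------------
-- HardMHV

-- The colour i ∈ {1,…,k} is the element i ∸ 1 of Fin k.

Colouring : ℕ → ℕ → Set
Colouring n k = Vec (Fin k) n

PartialColouring : ℕ → ℕ → Set
PartialColouring n k = Vec (Maybe (Fin k)) n

record Instance : Set where
  field
    n         : ℕ
    graph     : Graph n
    k         : ℕ
    precolour : PartialColouring n k
    q         : ℕ

  open Graph graph public

  Δ : ℕ
  Δ = maxDegree

  field
    connected : Connected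
    0<k       : 0 < k
    0<q       : 0 < q
    q≤Δ       : q ≤ Δ

  Extends : Colouring n k → Set
  Extends c′ = ∀ v → Maybe.All (lookup c′ v ≡_) (lookup precolour v)

  extends? : Decidable Extends
  extends? c′ = Fin.all? λ v → Maybe.dec (lookup c′ v Fin.≟_) (lookup precolour v)

  likeNeighbours : Colouring n k → Fin n → Subset n
  likeNeighbours c′ v =
    tabulate λ u → adj v u ∧ does (lookup c′ u Fin.≟ lookup c′ v)

  Happy : Colouring n k → Fin n → Set
  Happy c′ v = q ≤ ∣ likeNeighbours c′ v ∣

  happy? : ∀ c′ → Decidable (Happy c′)
  happy? c′ v = q ℕ.≤? ∣ likeNeighbours c′ v ∣

  #happy : Colouring n k → ℕ
  #happy c′ = ∣ tabulate (λ v → does (happy? c′ v)) ∣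

allColourings : ∀ n k → List (Colouring n k)
allColourings zero    k = [] ∷ []
allColourings (suc n) k = cartesianProductWith _∷_ (allFin k) (allColourings n k)

-- The default value 0 of max is never needed, since some total colouring
-- extends the given one; see OPT-attained.

OPT : Instance → ℕ
OPT I = max 0 (map #happy (filter extends? (allColourings n k)))
  where open Instance I

allColourings-complete : ∀ {n k} (c′ : Colouring n k) → c′ ∈ allColourings n k
allColourings-complete []       = here refl
allColourings-complete (x ∷ c′) =
  Mem.∈-cartesianProductWith⁺ _∷_ (Mem.∈-allFin x) (allColourings-complete c′)

module _ (I : Instance) where
  open Instance I

  OPT-upper : ∀ c′ → Extends c′ → #happy c′ ≤ OPT I
  OPT-upper c′ ext = All.lookup (xs≤max 0 _)
    (Mem.∈-map⁺ #happy (Mem.∈-filter⁺ extends? (allColourings-complete c′) ext))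

  private
    fill : Maybe (Fin k) → Fin k
    fill = maybe′ id (fromℕ< 0<k)

    filled : Colouring n k
    filled = tabulate (fill ∘ lookup precolour)

    fill-extends : ∀ m → Maybe.All (fill m ≡_) m
    fill-extends (just _) = Maybe.just refl
    fill-extends nothing  = Maybe.nothing

    filled-extends : Extends filled
    filled-extends v =
      subst (λ x → Maybe.All (x ≡_) (lookup precolour v))
            (sym (lookup∘tabulate (fill ∘ lookup precolour) v))
            (fill-extends (lookup precolour v))

  OPT-attained : ∃[ c′ ] Extends c′ × #happy c′ ≡ OPT I
  OPT-attained with argmax-sel id 0 (map #happy (filter extends? (allColourings n k)))
  ... | inj₁ OPT≡0 = filled , filled-extends ,
    trans (ℕ.n≤0⇒n≡0 (subst (#happy filled ≤_) OPT≡0 (OPT-upper filled filled-extends)))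
          (sym OPT≡0)
  ... | inj₂ OPT∈ with Mem.∈-map⁻ #happy OPT∈
  ...   | c′ , c′∈ , eq with Mem.∈-filter⁻ extends? {xs = allColourings n k} c′∈
  ...     | _ , ext = c′ , ext , sym eq

------------------------------------------------------------------------
-- Programs
--
-- A random access machine with structured control flow.  The memory is a
-- family of unbounded arrays of natural numbers; a program names arrays by
-- literals only, so it uses finitely many of them, while indices are
-- computed.  Every operation has unit cost.  As there is no
-- multiplication, t steps increase the bit length of the stored numbers by
-- O(t) only, so polynomial time here coincides with polynomial time on
-- Turing machines.

data Expr : Set where
  lit     : ℕ → Expr
  _!_     : ℕ → Expr → Expr
  _⊕_ _⊖_ : Expr → Expr → Expr

data Program : Set where
  skip          : Program
  _[_]:=_        : ℕ → Expr → Expr → Program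
  _⨾_           : Program → Program → Program
  IF_THEN_ELSE_ : Expr → Program → Program → Program
  WHILE_DO_     : Expr → Program → Program

infix  8 _!_
infixl 6 _⊕_ _⊖_
infix  5 _[_]:=_
infixr 4 _⨾_

Memory : Set
Memory = ℕ → ℕ → ℕ

_[_,_↦_] : Memory → ℕ → ℕ → ℕ → Memory
(σ [ a , i ↦ x ]) b j =
  if does (b ℕ.≟ a) ∧ does (j ℕ.≟ i) then x else σ b j

⟦_⟧ : Expr → Memory → ℕ
⟦ lit x ⟧  σ = x
⟦ a ! e ⟧  σ = σ a (⟦ e ⟧ σ)
⟦ e ⊕ e′ ⟧ σ = ⟦ e ⟧ σ + ⟦ e′ ⟧ σ
⟦ e ⊖ e′ ⟧ σ = ⟦ e ⟧ σ ∸ ⟦ e′ ⟧ σ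

cost : Expr → ℕ
cost (lit x)  = 1
cost (a ! e)  = 1 + cost e
cost (e ⊕ e′) = 1 + cost e + cost e′
cost (e ⊖ e′) = 1 + cost e + cost e′

-- ⟨ P , σ ⟩⇓ σ′ [ t ] : started in σ, P halts in σ′ after exactly t steps.

data ⟨_,_⟩⇓_[_] : Program → Memory → Memory → ℕ → Set where
  skip : ∀ {σ} → ⟨ skip , σ ⟩⇓ σ [ 1 ]
  assign : ∀ {σ a e e′} →
    ⟨ a [ e ]:= e′ , σ ⟩⇓ σ [ a , ⟦ e ⟧ σ ↦ ⟦ e′ ⟧ σ ] [ 1 + cost e + cost e′ ]
  seq : ∀ {σ σ′ σ″ P Q s t} →
    ⟨ P , σ ⟩⇓ σ′ [ s ] → ⟨ Q , σ′ ⟩⇓ σ″ [ t ] → ⟨ P ⨾ Q , σ ⟩⇓ σ″ [ s + t ]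
  if-true : ∀ {σ σ′ e P Q t} →
    ⟦ e ⟧ σ ≢ 0 → ⟨ P , σ ⟩⇓ σ′ [ t ] →
    ⟨ IF e THEN P ELSE Q , σ ⟩⇓ σ′ [ 1 + cost e + t ]
  if-false : ∀ {σ σ′ e P Q t} →
    ⟦ e ⟧ σ ≡ 0 → ⟨ Q , σ ⟩⇓ σ′ [ t ] →
    ⟨ IF e THEN P ELSE Q , σ ⟩⇓ σ′ [ 1 + cost e + t ]
  while-true : ∀ {σ σ′ σ″ e P s t} →
    ⟦ e ⟧ σ ≢ 0 → ⟨ P , σ ⟩⇓ σ′ [ s ] → ⟨ WHILE e DO P , σ′ ⟩⇓ σ″ [ t ] →
    ⟨ WHILE e DO P , σ ⟩⇓ σ″ [ 1 + cost e + s + t ]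
  while-false : ∀ {σ e P} →
    ⟦ e ⟧ σ ≡ 0 → ⟨ WHILE e DO P , σ ⟩⇓ σ [ 1 + cost e ]

-- The input is placed in array 0 and the output is read from array 1.

nth : List ℕ → ℕ → ℕ
nth []       _       = 0
nth (x ∷ xs) zero    = x
nth (x ∷ xs) (suc i) = nth xs i

load : List ℕ → Memory
load xs zero    = nth xs
load xs (suc a) = λ _ → 0

output : ∀ m → Memory → Vec ℕ m
output m σ = tabulate λ (i : Fin m) → σ 1 (toℕ i)

_on_yields_within_ : ∀ {m} → Program → List ℕ → Vec ℕ m → ℕ → Set
P on xs yields ys within b =
  ∃[ σ ] ∃[ t ] ⟨ P , load xs ⟩⇓ σ [ t ] × output _ σ ≡ ys × t ≤ b

bitSize : List ℕ → ℕ
bitSize xs = sum (map (λ x → suc ⌊log₂ x ⌋) xs)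

------------------------------------------------------------------------
-- Encoding of instances and colourings

colourCode : ∀ {k} → Fin k → ℕ
colourCode i = suc (toℕ i)

-- n, k, q, then the given colours (0 for an uncoloured vertex), then the
-- adjacency matrix row by row.  All numbers, k included, count with their
-- binary length in bitSize.

encode : Instance → List ℕ
encode I =
  n ∷ k ∷ q ∷
  Vec.toList (Vec.map (maybe′ colourCode 0) precolour) ++
  concatMap (λ u → map (λ v → if adj u v then 1 else 0) (allFin n)) (allFin n)
  where open Instance I

encodeColouring : ∀ {n k} → Colouring n k → Vec ℕ n
encodeColouring = Vec.map colourCode

{-# OPTIONS --safe #-}
module Submission where

-- Let N[v] be the closed neighbourhood of v.  Call v feasible for the colour i if
-- v and q of its neighbours are uncoloured or have the colour i.  The greedy
-- algorithm goes through the vertices v and a list of candidate colours i, and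
-- whenever v is feasible for i under the current colouring, it gives the
-- uncoloured vertices of N[v] the colour i; then v stays happy ("settled").  The
-- number of colours may be exponential in the size of the input, but the given
-- colours and the colour 1 suffice as candidates: if v is happy in some extension,
-- it is feasible for one of them under the given colouring.  If such a v is not
-- settled in the end, some x in N[v] was coloured by the algorithm, so
-- x ∈ N[w] for a settled w.  Hence the happy vertices of an optimal solution lie
-- in N[N[S]] for the set S of settled vertices, and OPT ≤ (1+Δ)² |S| ≤ 4 Δ³ |S|.

open import Defs
open import Data.Bool.Base using (Bool; true; false; if_then_else_; _∧_; not; T)
open import Data.Bool.Properties using (T?; T-∧)
open import Data.Fin.Base using (Fin; zero; suc; toℕ; fromℕ<)
import Data.Fin.Properties as Fin
open import Data.Fin.Subset using (∣_∣)
open import Data.Integer.Base as ℤ using (+_)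
import Data.Integer.Properties as ℤ
open import Data.List.Base as List using (List; []; _∷_; _++_; map; allFin; concatMap; length)
open import Data.List.Extrema.Nat using (xs≤max)
import Data.List.Membership.Propositional.Properties as Mem
import Data.List.Relation.Unary.All as All
open import Data.Maybe.Base using (just; nothing; maybe′)
import Data.Maybe.Relation.Unary.All as Maybe
open import Data.Nat.Base
  using (ℕ; zero; suc; _+_; _*_; _∸_; _^_; _⊔_; _≡ᵇ_; _≤_; _<_; z≤n; s≤s; NonZero)
open import Data.Nat.Properties using (m^n≢0)
import Data.Nat.Properties as ℕ
open import Data.Nat.Tactic.RingSolver using (solve-∀)
open import Data.Product.Base using (∃-syntax; _×_; _,_; proj₁; proj₂)
open import Data.Rational.Base as ℚ using (ℚ; 0ℚ; _/_; toℚᵘ)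
import Data.Rational.Properties as ℚ
import Data.Rational.Unnormalised.Base as ℚᵘ
import Data.Rational.Unnormalised.Properties as ℚᵘ
open import Data.Sum.Base using (_⊎_; inj₁; inj₂; [_,_]′)
open import Data.Unit.Base using (tt)
open import Data.Vec.Base as Vec using (Vec; []; _∷_; lookup; tabulate)
open import Data.Vec.Properties using (lookup∘tabulate; tabulate-cong; tabulate-∘; lookup-map)
open import Function.Base using (_∘_; id; case_of_)
open import Function.Bundles using (Equivalence)
open import Level using (0ℓ)
open import Relation.Binary.PropositionalEquality
open import Relation.Nullary.Decidable
  using (Dec; yes; no; does; _×-dec_; _⊎-dec_; dec-true; dec-false; ¬?)
open import Relation.Nullary.Negation using (contradiction; ¬_)
open import Relation.Unary using (Pred; Decidable)

-- Counting

-- Counting through `does` makes `#happy`, `degree` and the size of `likeNeighbours` instances of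
-- `#` by computation alone.
# : ∀ {n} {P : Pred (Fin n) 0ℓ} → Decidable P → ℕ
# P? = ∣ tabulate (does ∘ P?) ∣

indicator : ∀ {A : Set} → Dec A → ℕ
indicator a? = if does a? then 1 else 0

#-∪ : ∀ {n} {P Q R : Pred (Fin n) 0ℓ} (P? : Decidable P) (Q? : Decidable Q) (R? : Decidable R) →
      (∀ x → P x → Q x ⊎ R x) → # P? ≤ # Q? + # R?
#-∪ {zero}  P? Q? R? P⇒Q∪R = z≤n
#-∪ {suc n} P? Q? R? P⇒Q∪R
  with #-∪ (P? ∘ suc) (Q? ∘ suc) (R? ∘ suc) (P⇒Q∪R ∘ suc) | P? zero | Q? zero | R? zero
... | ih | no  _ | no  _ | no  _ = ih
... | ih | no  _ | yes _ | no  _ = ℕ.m≤n⇒m≤1+n ih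
... | ih | no  _ | no  _ | yes _ = ℕ.≤-trans ih (ℕ.+-monoʳ-≤ _ (ℕ.n≤1+n _))
... | ih | no  _ | yes _ | yes _ = ℕ.m≤n⇒m≤1+n (ℕ.≤-trans ih (ℕ.+-monoʳ-≤ _ (ℕ.n≤1+n _)))
... | ih | yes p | no ¬q | no ¬r = contradiction (P⇒Q∪R zero p) [ ¬q , ¬r ]′
... | ih | yes _ | yes _ | no  _ = s≤s ih
... | ih | yes _ | no  _ | yes _ =
  ℕ.≤-trans (s≤s ih) (ℕ.≤-reflexive (sym (ℕ.+-suc _ _)))
... | ih | yes _ | yes _ | yes _ = s≤s (ℕ.≤-trans ih (ℕ.+-monoʳ-≤ _ (ℕ.n≤1+n _)))

#-none : ∀ {n} {P : Pred (Fin n) 0ℓ} (P? : Decidable P) → (∀ x → ¬ P x) → # P? ≡ 0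
#-none {zero}  P? none = refl
#-none {suc n} P? none with P? zero
... | yes p = contradiction p (none zero)
... | no  _ = #-none (P? ∘ suc) (none ∘ suc)

#-mono : ∀ {n} {P Q : Pred (Fin n) 0ℓ} (P? : Decidable P) (Q? : Decidable Q) →
         (∀ x → P x → Q x) → # P? ≤ # Q?
#-mono {zero}  P? Q? P⇒Q = z≤n
#-mono {suc n} P? Q? P⇒Q with #-mono (P? ∘ suc) (Q? ∘ suc) (P⇒Q ∘ suc) | P? zero | Q? zero
... | ih | no  _ | no  _ = ih
... | ih | no  _ | yes _ = ℕ.m≤n⇒m≤1+n ih
... | ih | yes p | no ¬q = contradiction (P⇒Q zero p) ¬q
... | ih | yes _ | yes _ = s≤s ih

#-≟ : ∀ {n} (v : Fin n) → # (Fin._≟ v) ≤ 1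
#-≟ {suc n} zero    = s≤s (ℕ.≤-reflexive (#-none {n} {λ x → suc x ≡ zero} (λ x → suc x Fin.≟ zero) (λ _ ())))
#-≟ {suc n} (suc v) = ℕ.≤-trans
  (#-mono (λ x → suc x Fin.≟ suc v) (Fin._≟ v) (λ _ → Fin.suc-injective)) (#-≟ v)

#-⋃ : ∀ {m n D} {P : Pred (Fin n) 0ℓ} {S : Pred (Fin m) 0ℓ} {R : Fin m → Pred (Fin n) 0ℓ}
      (P? : Decidable P) (S? : Decidable S) (R? : ∀ v → Decidable (R v)) →
      (∀ v → # (R? v) ≤ D) → (∀ x → P x → ∃[ v ] S v × R v x) → # P? ≤ # S? * D
#-⋃ {zero} P? S? R? R≤D cover =
  ℕ.≤-reflexive (#-none P? (λ x p → case cover x p of λ ()))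
#-⋃ {suc m} {D = D} {P} {S} {R} P? S? R? R≤D cover with S? zero
... | no ¬s = #-⋃ P? (S? ∘ suc) (R? ∘ suc) (R≤D ∘ suc) λ x p → case cover x p of λ where
  (zero  , s , _) → contradiction s ¬s
  (suc v , s , r) → v , s , r
... | yes _ = ℕ.≤-trans (#-∪ P? (R? zero) Rest? split)
  (ℕ.+-mono-≤ (R≤D zero) (#-⋃ Rest? (S? ∘ suc) (R? ∘ suc) (R≤D ∘ suc) λ _ → proj₂))
  where
  -- What `R zero` misses is reached from a later index. Keeping that witness in `Rest` makes the
  -- cover for the recursive call a projection.
  Rest : Pred (Fin _) 0ℓ
  Rest x = P x × ∃[ v ] S (suc v) × R (suc v) x

  Rest? : Decidable Rest
  Rest? x = P? x ×-dec Fin.any? λ v → S? (suc v) ×-dec R? (suc v) x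

  split : ∀ x → P x → R zero x ⊎ Rest x
  split x p with cover x p
  ... | zero  , _ , r = inj₁ r
  ... | suc v , s , r = inj₂ (p , v , s , r)

-- The content of `tally` after `j` rounds of the counting loop; `tallies` takes it as the loop
-- invariant.
#below : ∀ {n} {P : Pred (Fin n) 0ℓ} → Decidable P → ℕ → ℕ
#below         P? zero    = 0
#below {zero}  P? (suc j) = 0
#below {suc n} P? (suc j) = indicator (P? zero) + #below (P? ∘ suc) j

#below-suc : ∀ {n} {P : Pred (Fin n) 0ℓ} (P? : Decidable P) i →
             #below P? (suc (toℕ i)) ≡ #below P? (toℕ i) + indicator (P? i)
#below-suc P? zero    = ℕ.+-identityʳ _
#below-suc P? (suc i) = trans (cong (λ m → indicator (P? zero) + m) (#below-suc (P? ∘ suc) i))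
                              (sym (ℕ.+-assoc (indicator (P? zero)) _ _))

#below-all : ∀ {n} {P : Pred (Fin n) 0ℓ} (P? : Decidable P) → #below P? n ≡ # P?
#below-all {zero}  P? = refl
#below-all {suc n} P? with P? zero
... | yes _ = cong suc (#below-all (P? ∘ suc))
... | no  _ = #below-all (P? ∘ suc)

-- Arithmetic

-- Unnormalised fractions are compared by cross multiplication, which turns the claim into the
-- hypothesis; `/` normalises, hence the detour through `toℚᵘ`.
¼*o/d≤h : ∀ o d h .{{_ : NonZero d}} → o ≤ h * (4 * d) →
          (+ 1 / 4) ℚ.* (+ o / d) ℚ.≤ + h / 1
¼*o/d≤h o (suc d) h o≤4dh = ℚ.toℚᵘ-cancel-≤ (begin
  toℚᵘ ((+ 1 / 4) ℚ.* (+ o / suc d))        ≃⟨ ℚ.toℚᵘ-homo-* (+ 1 / 4) (+ o / suc d) ⟩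
  toℚᵘ (+ 1 / 4) ℚᵘ.* toℚᵘ (+ o / suc d)    ≃⟨ ℚᵘ.*-congˡ {toℚᵘ (+ 1 / 4)} (ℚ.toℚᵘ-fromℚᵘ (ℚᵘ.mkℚᵘ (+ o) d)) ⟩
  toℚᵘ (+ 1 / 4) ℚᵘ.* ℚᵘ.mkℚᵘ (+ o) d       ≤⟨ ℚᵘ.*≤* cross ⟩
  ℚᵘ.mkℚᵘ (+ h) 0                           ≃⟨ ℚ.toℚᵘ-fromℚᵘ (ℚᵘ.mkℚᵘ (+ h) 0) ⟨
  toℚᵘ (+ h / 1)                            ∎)
  where
  open ℚᵘ.≤-Reasoning
  cross : (+ 1 ℤ.* + o) ℤ.* + 1 ℤ.≤ + h ℤ.* + (4 * suc d)
  cross = subst₂ ℤ._≤_ (sym (trans (ℤ.*-identityʳ _) (ℤ.*-identityˡ (+ o)))) (ℤ.pos-* h (4 * suc d)) (ℤ.+≤+ o≤4dh)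

-- For `d = 1 + e` the difference of the two sides is a polynomial in `e` with nonnegative
-- coefficients. It vanishes at `e = 0`, so 4 is the least constant that works here; this gives the
-- ratio 1/4.
[1+d]²≤4d³ : ∀ d .{{_ : NonZero d}} → suc d * suc d ≤ 4 * d ^ 3
[1+d]²≤4d³ (suc e) = ℕ.≤-trans (ℕ.m≤m+n _ (4 * e * e * e + 11 * e * e + 8 * e)) (ℕ.≤-reflexive (expand e))
  where
  expand : ∀ e → (2 + e) * (2 + e) + (4 * e * e * e + 11 * e * e + 8 * e) ≡
                 4 * ((1 + e) * ((1 + e) * ((1 + e) * 1)))
  expand = solve-∀

-- Programs

store-hit : ∀ σ a i x → (σ [ a , i ↦ x ]) a i ≡ x
store-hit σ a i x rewrite dec-true (a ℕ.≟ a) refl | dec-true (i ℕ.≟ i) refl = refl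

store-miss : ∀ σ a {i j} x → j ≢ i → (σ [ a , i ↦ x ]) a j ≡ σ a j
store-miss σ a {i} {j} x j≢i rewrite dec-true (a ℕ.≟ a) refl | dec-false (j ℕ.≟ i) j≢i = refl

-- Programs name arrays by literals, so a syntactic check suffices, and for concrete programs its
-- proofs are `tt`.
unwritten : ℕ → Program → Bool
unwritten a skip                   = true
unwritten a (b [ _ ]:= _)          = not (does (a ℕ.≟ b))
unwritten a (P ⨾ Q)                = unwritten a P ∧ unwritten a Q
unwritten a (IF _ THEN P ELSE Q)   = unwritten a P ∧ unwritten a Q
unwritten a (WHILE _ DO P)         = unwritten a P

Frame : Program → Memory → Memory → Set
Frame P σ σ′ = ∀ a → T (unwritten a P) → ∀ i → σ′ a i ≡ σ a i

T-∧⁻ : ∀ {x y} → T (x ∧ y) → T x × T y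
T-∧⁻ = Equivalence.to T-∧

frame : ∀ {P σ σ′ t} → ⟨ P , σ ⟩⇓ σ′ [ t ] → Frame P σ σ′
frame skip a _ i = refl
frame (assign {a = b}) a a∉ i with a ≡ᵇ b
... | false = refl
frame (seq D E) a a∉ i =
  trans (frame E a (proj₂ (T-∧⁻ a∉)) i) (frame D a (proj₁ (T-∧⁻ a∉)) i)
frame (if-true  _ D) a a∉ i = frame D a (proj₁ (T-∧⁻ a∉)) i
frame (if-false {P = P} _ D) a a∉ i = frame D a (proj₂ (T-∧⁻ {unwritten a P} a∉)) i
frame (while-true _ D E) a a∉ i = trans (frame E a a∉ i) (frame D a a∉ i)
frame (while-false _) a _ i = refl

-- Running time of nested loops

depth : Program → ℕ
depth skip                 = 0
depth (_ [ _ ]:= _)        = 0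
depth (P ⨾ Q)              = depth P ⊔ depth Q
depth (IF _ THEN P ELSE Q) = depth P ⊔ depth Q
depth (WHILE _ DO P)       = suc (depth P)

-- Bounds the running time if every loop makes at most N iterations.
time : ℕ → Program → ℕ
time N skip                 = 1
time N (_ [ e ]:= e′)       = 1 + cost e + cost e′
time N (P ⨾ Q)              = time N P + time N Q
time N (IF e THEN P ELSE Q) = 1 + cost e + (time N P + time N Q)
time N (WHILE e DO P)       = suc N * (1 + cost e + time N P)

module _ (N : ℕ) where
  private
    lift : ∀ {d e} b → d ≤ e → b * suc N ^ d ≤ b * suc N ^ e
    lift b d≤e = ℕ.*-monoʳ-≤ b (ℕ.^-monoʳ-≤ (suc N) d≤e)

    constant : ∀ b d → b ≤ b * suc N ^ d
    constant b d = ℕ.m≤m*n b (suc N ^ d) {{ℕ.m^n≢0 (suc N) d}}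

    combine : ∀ {s t} b c d e → s ≤ b * suc N ^ d → t ≤ c * suc N ^ e → s + t ≤ (b + c) * suc N ^ (d ⊔ e)
    combine {s} {t} b c d e s≤ t≤ = ℕ.≤-trans
      (ℕ.+-mono-≤ (ℕ.≤-trans s≤ (lift b (ℕ.m≤m⊔n d e))) (ℕ.≤-trans t≤ (lift c (ℕ.m≤n⊔m d e))))
      (ℕ.≤-reflexive (sym (ℕ.*-distribʳ-+ (suc N ^ (d ⊔ e)) b c)))

  -- Each enclosing loop contributes one factor `suc N`, so the nesting depth is the degree. The
  -- coefficient `time 0 P` is the charge with all these factors set to 1, and since `suc N` is at
  -- least 1 a smaller degree can be raised to a larger one.
  time-polynomial : ∀ P → time N P ≤ time 0 P * suc N ^ depth P
  time-polynomial skip          = constant 1 0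
  time-polynomial (_ [ e ]:= e′) = constant (1 + cost e + cost e′) 0
  time-polynomial (P ⨾ Q) =
    combine (time 0 P) (time 0 Q) (depth P) (depth Q) (time-polynomial P) (time-polynomial Q)
  time-polynomial (IF e THEN P ELSE Q) =
    combine (1 + cost e) (time 0 P + time 0 Q) 0 (depth P ⊔ depth Q) (constant (1 + cost e) 0)
      (combine (time 0 P) (time 0 Q) (depth P) (depth Q) (time-polynomial P) (time-polynomial Q))
  time-polynomial (WHILE e DO P) = begin
    suc N * (1 + cost e + time N P)              ≤⟨ ℕ.*-monoʳ-≤ (suc N) (combine (1 + cost e) (time 0 P) 0 (depth P) (constant (1 + cost e) 0) (time-polynomial P)) ⟩
    suc N * (B * suc N ^ depth P)                ≡⟨ x*[y*z]≡y*[x*z] (suc N) B (suc N ^ depth P) ⟩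
    -- The coefficient of a loop, `time 0`, unfolds to `1 * B`, that is, to `B + 0`.
    B * suc N ^ suc (depth P)                    ≤⟨ ℕ.*-monoˡ-≤ (suc N ^ suc (depth P)) (ℕ.m≤m+n B 0) ⟩
    (B + 0) * suc N ^ suc (depth P)              ∎
    where
    open ℕ.≤-Reasoning
    B : ℕ
    B = 1 + cost e + time 0 P
    x*[y*z]≡y*[x*z] : ∀ x y z → x * (y * z) ≡ y * (x * z)
    x*[y*z]≡y*[x*z] = solve-∀

-- Total correctness with time bounds

record Runs (N : ℕ) (P : Program) (σ : Memory) (Φ : Memory → Set) : Set where
  constructor runs
  field
    {final}   : Memory
    {steps}   : ℕ
    halts     : ⟨ P , σ ⟩⇓ final [ steps ]
    in-time   : steps ≤ time N P
    satisfies : Φ final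

module _ {N : ℕ} where

  skips : ∀ {σ} {Φ : Memory → Set} → Φ σ → Runs N skip σ Φ
  skips φ = runs skip ℕ.≤-refl φ

  assigns : ∀ {σ a e e′} {Φ : Memory → Set} →
            Φ (σ [ a , ⟦ e ⟧ σ ↦ ⟦ e′ ⟧ σ ]) → Runs N (a [ e ]:= e′) σ Φ
  assigns φ = runs assign ℕ.≤-refl φ

  -- The continuation also receives the frame of the first program, so postconditions need to
  -- mention only the arrays that change.
  _then_ : ∀ {P Q σ Φ Ψ} → Runs N P σ Φ →
           (∀ σ′ → Frame P σ σ′ → Φ σ′ → Runs N Q σ′ Ψ) → Runs N (P ⨾ Q) σ Ψ
  runs D s≤ φ then next with next _ (frame D) φ
  ... | runs E t≤ ψ = runs (seq D E) (ℕ.+-mono-≤ s≤ t≤) ψ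

  ensuring : ∀ {P σ} {Φ Ψ : Memory → Set} → Runs N P σ Φ →
             (∀ σ′ → Frame P σ σ′ → Φ σ′ → Ψ σ′) → Runs N P σ Ψ
  ensuring (runs D t≤ φ) Φ⇒Ψ = runs D t≤ (Φ⇒Ψ _ (frame D) φ)

  branches : ∀ {e P Q σ Φ} →
             (⟦ e ⟧ σ ≢ 0 → Runs N P σ Φ) → (⟦ e ⟧ σ ≡ 0 → Runs N Q σ Φ) →
             Runs N (IF e THEN P ELSE Q) σ Φ
  branches {e} {P} {Q} {σ} P-runs Q-runs with ⟦ e ⟧ σ ℕ.≟ 0
  ... | yes e≡0 with Q-runs e≡0
  ...   | runs D t≤ φ = runs (if-false e≡0 D)
    (ℕ.+-monoʳ-≤ (1 + cost e) (ℕ.≤-trans t≤ (ℕ.m≤n+m (time N Q) (time N P)))) φ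
  branches {e} {P} {Q} {σ} P-runs Q-runs | no e≢0 with P-runs e≢0
  ...   | runs D t≤ φ = runs (if-true e≢0 D)
    (ℕ.+-monoʳ-≤ (1 + cost e) (ℕ.≤-trans t≤ (ℕ.m≤m+n (time N P) (time N Q)))) φ

var : ℕ → Expr
var x = x ! lit 0

-- Runs P for x = 0, …, n ∸ 1, where n is the first entry of the input.
FOR : ℕ → Program → Program
FOR x P = x [ lit 0 ]:= lit 0 ⨾ WHILE var 0 ⊖ var x DO (P ⨾ x [ lit 0 ]:= lit 1 ⊕ var x)

module _ {N x P} (σ₀ : Memory) (Inv : ℕ → Memory → Set)
  (0∉ : T (unwritten 0 (FOR x P))) (x∉P : T (unwritten x P)) (N≡ : σ₀ 0 0 ≡ N)
  (body : ∀ (i : Fin N) σ → Frame (FOR x P) σ₀ σ → σ x 0 ≡ toℕ i → Inv (toℕ i) σ →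
          Runs N P σ λ σ′ → Inv (suc (toℕ i)) (σ′ [ x , 0 ↦ suc (σ′ x 0) ]))
  where
  private
    Body : Program
    Body = P ⨾ x [ lit 0 ]:= lit 1 ⊕ var x

    -- Induction on the number `r` of rounds left; the factor `suc r` includes the last, failing
    -- test of the guard. The frame is kept relative to `σ₀`, so every round can use what was known
    -- before the loop.
    loop : ∀ r i → i + r ≡ N → ∀ σ → Frame (FOR x P) σ₀ σ → σ x 0 ≡ i → Inv i σ →
           ∃[ σ′ ] ∃[ t ] ⟨ WHILE var 0 ⊖ var x DO Body , σ ⟩⇓ σ′ [ t ] ×
             t ≤ suc r * (6 + time N Body) × Inv N σ′
    loop zero i i+0≡N σ fr x≡i inv = σ , _ ,
      while-false (trans (cong₂ _∸_ (trans (fr 0 0∉ 0) N≡) x≡i)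
                         (ℕ.m≤n⇒m∸n≡0 (ℕ.≤-reflexive (sym i≡N)))) ,
      ℕ.m≤m+n 6 _ , subst (λ j → Inv j σ) i≡N inv
      where
      i≡N : i ≡ N
      i≡N = trans (sym (ℕ.+-identityʳ i)) i+0≡N
    loop (suc r) i i+r≡N σ fr x≡i inv
      with i<N ← subst (i <_) i+r≡N (ℕ.m<m+n i (s≤s z≤n))
      with fromℕ< i<N | Fin.toℕ-fromℕ< i<N
    ... | j | refl with body j σ fr x≡i inv
    ... | runs {σ₁} D s≤ inv₁
      with loop r (suc (toℕ j)) (trans (sym (ℕ.+-suc (toℕ j) r)) i+r≡N) (σ₁ [ x , 0 ↦ suc (σ₁ x 0) ])
             (λ a a∉ k → trans (frame (seq D (assign {e = lit 0} {lit 1 ⊕ var x})) a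
                                      (proj₂ (T-∧⁻ {not (does (a ℕ.≟ x))} a∉)) k)
                               (fr a a∉ k))
             (trans (store-hit σ₁ x 0 _) (cong suc (trans (frame D x x∉P 0) x≡i)))
             inv₁
    ... | σ₂ , t , E , t≤ , inv₂ = σ₂ , _ ,
      while-true (λ e≡0 → ℕ.m>n⇒m∸n≢0 i<N
                   (trans (sym (cong₂ _∸_ (trans (fr 0 0∉ 0) N≡) x≡i)) e≡0))
                 (seq D assign) E ,
      -- The first 6 pays for one test of the guard, the second for incrementing the counter.
      ℕ.+-mono-≤ (ℕ.+-monoʳ-≤ 6 (ℕ.+-monoˡ-≤ 6 s≤)) t≤ , inv₂

  for : Inv 0 (σ₀ [ x , 0 ↦ 0 ]) → Runs N (FOR x P) σ₀ (Inv N)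
  for inv with loop N 0 refl (σ₀ [ x , 0 ↦ 0 ])
                 (λ a a∉ → frame (assign {σ₀} {x} {lit 0} {lit 0}) a (proj₁ (T-∧⁻ a∉)))
                 (store-hit σ₀ x 0 0) inv
  ... | _ , _ , D , t≤ , inv′ = runs (seq assign D) (ℕ.+-monoʳ-≤ 3 t≤) inv′

-- Encoding

nth-toList : ∀ {n} (xs : Vec ℕ n) ys i → nth (Vec.toList xs ++ ys) (toℕ i) ≡ lookup xs i
nth-toList (x ∷ xs) ys zero    = refl
nth-toList (x ∷ xs) ys (suc i) = nth-toList xs ys i

nth-past-toList : ∀ {n} (xs : Vec ℕ n) ys j → nth (Vec.toList xs ++ ys) (n + j) ≡ nth ys j
nth-past-toList []       ys j = refl
nth-past-toList (x ∷ xs) ys j = nth-past-toList xs ys j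

nth-tabulate : ∀ {A : Set} {n} (f : A → ℕ) (g : Fin n → A) ys i →
               nth (map f (List.tabulate g) ++ ys) (toℕ i) ≡ f (g i)
nth-tabulate f g ys zero    = refl
nth-tabulate f g ys (suc i) = nth-tabulate f (g ∘ suc) ys i

nth-past-tabulate : ∀ {A : Set} {n} (f : A → ℕ) (g : Fin n → A) ys j →
                    nth (map f (List.tabulate g) ++ ys) (n + j) ≡ nth ys j
nth-past-tabulate {n = zero}  f g ys j = refl
nth-past-tabulate {n = suc n} f g ys j = nth-past-tabulate f (g ∘ suc) ys j

nth-matrix : ∀ {A : Set} {m n} (M : A → Fin n → ℕ) (g : Fin m → A) v w →
             nth (concatMap (λ u → map (M u) (allFin n)) (List.tabulate g)) (toℕ v * n + toℕ w) ≡
             M (g v) w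
nth-matrix {n = n} M g zero    w = nth-tabulate (M (g zero)) id _ w
nth-matrix {n = n} M g (suc v) w = begin
  nth rows (n + toℕ v * n + toℕ w)    ≡⟨ cong (nth rows) (ℕ.+-assoc n (toℕ v * n) (toℕ w)) ⟩
  nth rows (n + (toℕ v * n + toℕ w))  ≡⟨ nth-past-tabulate (M (g zero)) id _ _ ⟩
  _                                   ≡⟨ nth-matrix M (g ∘ suc) v w ⟩
  M (g (suc v)) w                     ∎
  where
  open ≡-Reasoning
  rows : List ℕ
  rows = concatMap (λ u → map (M u) (allFin n)) (List.tabulate g)

length≤bitSize : ∀ xs → length xs ≤ bitSize xs
length≤bitSize []       = z≤n
length≤bitSize (x ∷ xs) = s≤s (ℕ.≤-trans (length≤bitSize xs) (ℕ.m≤n+m _ _))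

n≤length-toList : ∀ {n} (xs : Vec ℕ n) ys → n ≤ length (Vec.toList xs ++ ys)
n≤length-toList []       ys = z≤n
n≤length-toList (x ∷ xs) ys = s≤s (n≤length-toList xs ys)

-- The maximum of `m` and 1, in a form that the machine computes without a branch. It turns the mark
-- 0 of an uncoloured vertex into the code of the first colour.
positive : ℕ → ℕ
positive m = m + (1 ∸ m)

positive>0 : ∀ m → 0 < positive m
positive>0 zero    = s≤s z≤n
positive>0 (suc m) = s≤s z≤n

positive-≢0 : ∀ {m} → m ≢ 0 → positive m ≡ m
positive-≢0 {zero}  m≢0 = contradiction refl m≢0
positive-≢0 {suc m} m≢0 = trans (cong (λ z → suc m + z) (ℕ.0∸n≡0 m)) (ℕ.+-identityʳ (suc m))

positive-≤ : ∀ {m k} → 0 < k → m ≤ k → positive m ≤ k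
positive-≤ {zero}  0<k _   = 0<k
positive-≤ {suc m} _   m≤k = ℕ.≤-trans (ℕ.≤-reflexive (positive-≢0 λ ())) m≤k

module _ (I : Instance) where
  open Instance I

  given : Fin n → ℕ
  given x = maybe′ colourCode 0 (lookup precolour x)

  encode-given : ∀ x → nth (encode I) (3 + toℕ x) ≡ given x
  encode-given x = trans (nth-toList (Vec.map (maybe′ colourCode 0) precolour) _ x) (lookup-map x _ precolour)

  encode-adj : ∀ v w → nth (encode I) (3 + n + toℕ v * n + toℕ w) ≡ (if adj v w then 1 else 0)
  encode-adj v w = begin
    nth (encode I) (3 + n + toℕ v * n + toℕ w)
      ≡⟨ cong (nth (encode I)) (ℕ.+-assoc (3 + n) (toℕ v * n) (toℕ w)) ⟩
    nth (encode I) (3 + n + (toℕ v * n + toℕ w))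
      ≡⟨ nth-past-toList (Vec.map (maybe′ colourCode 0) precolour) _ _ ⟩
    nth (concatMap (λ u → map (λ v → if adj u v then 1 else 0) (allFin n)) (allFin n)) (toℕ v * n + toℕ w)
      ≡⟨ nth-matrix (λ u v → if adj u v then 1 else 0) id v w ⟩
    (if adj v w then 1 else 0)
      ∎
    where open ≡-Reasoning

  n<bitSize : n < bitSize (encode I)
  n<bitSize = ℕ.≤-trans
    (s≤s (ℕ.m≤n⇒m≤1+n (ℕ.m≤n⇒m≤1+n (n≤length-toList (Vec.map (maybe′ colourCode 0) precolour) _))))
    (length≤bitSize (encode I))

  -- The greedy colouring

  -- An array of colour codes, in which 0 marks an uncoloured vertex.
  Codes : Set
  Codes = Fin n → ℕ

  -- Indexing the candidates by vertices gives `n` of them, however large `k` is; an uncoloured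
  -- vertex contributes the colour 1.
  candidate : Fin n → ℕ
  candidate u = positive (given u)

  Fits : ℕ → ℕ → Set
  Fits i m = m ≡ 0 ⊎ m ≡ i

  fits? : ∀ i m → Dec (Fits i m)
  fits? i m = (m ℕ.≟ 0) ⊎-dec (m ℕ.≟ i)

  supporter? : (c : Codes) (v : Fin n) (i : ℕ) → Decidable (λ u → v ~ u × Fits i (c u))
  supporter? c v i u = T? (adj v u) ×-dec fits? i (c u)

  Feasible : Codes → Fin n → ℕ → Set
  Feasible c v i = Fits i (c v) × q ≤ # (supporter? c v i)

  ally? : (c : Codes) (v : Fin n) → Decidable (λ u → v ~ u × c u ≡ c v)
  ally? c v u = T? (adj v u) ×-dec (c u ℕ.≟ c v)

  Settled : Codes → Fin n → Set
  Settled c v = c v ≢ 0 × q ≤ # (ally? c v)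

  Near : Fin n → Fin n → Set
  Near v x = x ≡ v ⊎ v ~ x

  near? : ∀ v → Decidable (Near v)
  near? v x = (x Fin.≟ v) ⊎-dec T? (adj v x)

  near-sym : ∀ {v x} → Near v x → Near x v
  near-sym (inj₁ x≡v) = inj₁ (sym x≡v)
  near-sym (inj₂ v~x) = inj₂ (subst T (symmetric _ _) v~x)

  paint : Codes → Fin n → ℕ → Codes
  paint c v i x = if does (near? v x ×-dec (c x ℕ.≟ 0)) then i else c x

  paint-new : ∀ c v i {x} → Near v x → c x ≡ 0 → paint c v i x ≡ i
  paint-new c v i {x} near c≡0 =
    cong (λ b → if b then i else c x) (dec-true (near? v x ×-dec (c x ℕ.≟ 0)) (near , c≡0))

  paint-old : ∀ c v i {x} → ¬ (Near v x × c x ≡ 0) → paint c v i x ≡ c x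
  paint-old c v i {x} ¬new =
    cong (λ b → if b then i else c x) (dec-false (near? v x ×-dec (c x ℕ.≟ 0)) ¬new)

  paint-fits : ∀ c v i {x} → Near v x → Fits i (c x) → paint c v i x ≡ i
  paint-fits c v i near (inj₁ c≡0) = paint-new c v i near c≡0
  paint-fits c v i {x} near (inj₂ c≡i) with c x ℕ.≟ 0
  ... | yes c≡0 = paint-new c v i near c≡0
  ... | no  c≢0 = trans (paint-old c v i (c≢0 ∘ proj₂)) c≡i

  _⊑_ : Codes → Codes → Set
  c ⊑ d = ∀ x → c x ≢ 0 → d x ≡ c x

  ⊑-paint : ∀ c v i → c ⊑ paint c v i
  ⊑-paint c v i x c≢0 = paint-old c v i (c≢0 ∘ proj₂)

  -- The allies of a settled vertex share its nonzero code, hence are coloured themselves and keep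
  -- their codes in `d`.
  settled-mono : ∀ {c d v} → c ⊑ d → Settled c v → Settled d v
  settled-mono {c} {d} {v} c⊑d (c≢0 , q≤) =
    c≢0 ∘ trans (sym (c⊑d v c≢0)) , ℕ.≤-trans q≤ (#-mono (ally? c v) (ally? d v) λ u (v~u , c≡) →
      v~u , trans (c⊑d u (c≢0 ∘ trans (sym c≡))) (trans c≡ (sym (c⊑d v c≢0))))

  record Valid (c : Codes) : Set where
    field
      extends : given ⊑ c
      bounded : ∀ x → c x ≤ k
      charged : ∀ x → c x ≢ given x → ∃[ v ] Settled c v × Near v x

  open Valid

  -- Feasibility refers to the given colouring, because that is what happiness in an optimal
  -- solution provides. An attempt can then fail only if the algorithm has already changed something
  -- near `v`.
  Tried : Codes → Fin n → Fin n → Set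
  Tried c v u = Feasible given v (candidate u) →
                Settled c v ⊎ ∃[ x ] Near v x × c x ≢ given x

  -- A vertex where `c` differs from `given` is coloured in `c`, as `c` extends `given`; so `d`
  -- preserves the difference.
  tried-mono : ∀ {c d v u} → given ⊑ c → c ⊑ d → Tried c v u → Tried d v u
  tried-mono {c} {d} given⊑c c⊑d tried feasible with tried feasible
  ... | inj₁ settled = inj₁ (settled-mono c⊑d settled)
  ... | inj₂ (x , near , c≢) =
    inj₂ (x , near , λ d≡ → c≢ (trans (sym (c⊑d x c≢0)) d≡))
    where
    c≢0 : c x ≢ 0
    c≢0 c≡0 = c≢ (case given x ℕ.≟ 0 of λ where
      (yes g≡0) → trans c≡0 (sym g≡0)
      (no  g≢0) → given⊑c x g≢0)

  given-≤ : ∀ x → given x ≤ k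
  given-≤ x with lookup precolour x
  ... | just i  = Fin.toℕ<n i
  ... | nothing = z≤n

  candidate-≤ : ∀ u → candidate u ≤ k
  candidate-≤ u = positive-≤ 0<k (given-≤ u)

  given-valid : Valid given
  given-valid = record
    { extends = λ _ _ → refl
    ; bounded = given-≤
    ; charged = λ _ g≢g → contradiction refl g≢g
    }

  paint-settled : ∀ {c v i} → 0 < i → Feasible c v i → Settled (paint c v i) v
  paint-settled {c} {v} {i} 0<i (fits , q≤) =
    (λ p≡0 → ℕ.<⇒≢ 0<i (trans (sym p≡0) painted)) ,
    ℕ.≤-trans q≤ (#-mono (supporter? c v i) (ally? (paint c v i) v) λ u (v~u , fits-u) →
      v~u , trans (paint-fits c v i (inj₂ v~u) fits-u) (sym painted))
    where
    painted : paint c v i v ≡ i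
    painted = paint-fits c v i (inj₁ refl) fits

  -- Newly coloured vertices are charged to `v`, which has become settled; earlier charges survive
  -- by `settled-mono`.
  paint-valid : ∀ {c v i} → 0 < i → i ≤ k → Feasible c v i → Valid c → Valid (paint c v i)
  paint-valid {c} {v} {i} 0<i i≤k feasible valid = record
    { extends = λ x g≢0 → trans (⊑-paint c v i x (g≢0 ∘ trans (sym (extends valid x g≢0))))
                                (extends valid x g≢0)
    ; bounded = λ x → bound x
    ; charged = λ x p≢g → charge x p≢g
    }
    where
    bound : ∀ x → paint c v i x ≤ k
    bound x with near? v x ×-dec (c x ℕ.≟ 0)
    ... | yes (near , c≡0) = subst (_≤ k) (sym (paint-new c v i near c≡0)) i≤k
    ... | no  ¬new         = subst (_≤ k) (sym (paint-old c v i ¬new)) (bounded valid x)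

    charge : ∀ x → paint c v i x ≢ given x → ∃[ w ] Settled (paint c v i) w × Near w x
    charge x p≢g with near? v x ×-dec (c x ℕ.≟ 0)
    ... | yes (near , _) = v , paint-settled 0<i feasible , near
    ... | no  ¬new with charged valid x (p≢g ∘ trans (paint-old c v i ¬new))
    ...   | w , settled , near = w , settled-mono (⊑-paint c v i) settled , near

  -- If nothing near `v` has changed, `c` and `given` agree on all that feasibility at `v` depends
  -- on.
  infeasible-tried : ∀ {c v u} → ¬ Feasible c v (candidate u) → Tried c v u
  infeasible-tried {c} {v} {u} ¬feasible (fits , q≤)
    with Fin.any? (λ x → near? v x ×-dec ¬? (c x ℕ.≟ given x))
  ... | yes changed = inj₂ changed
  ... | no ¬changed = contradiction
    ( subst (Fits _) (sym (unchanged (inj₁ refl))) fits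
    , ℕ.≤-trans q≤ (#-mono (supporter? given v _) (supporter? c v _) λ w (v~w , fits-w) →
        v~w , subst (Fits _) (sym (unchanged (inj₂ v~w))) fits-w)
    ) ¬feasible
    where
    unchanged : ∀ {x} → Near v x → c x ≡ given x
    unchanged {x} near with c x ℕ.≟ given x
    ... | yes c≡g = c≡g
    ... | no  c≢g = contradiction (x , near , c≢g) ¬changed

  #-near : ∀ v → # (near? v) ≤ suc Δ
  #-near v = ℕ.≤-trans (#-∪ (near? v) (Fin._≟ v) (λ x → T? (adj v x)) λ _ near → near)
    (ℕ.+-mono-≤ (#-≟ v)
      (All.lookup (xs≤max 0 _) (Mem.∈-map⁺ degree (Mem.∈-allFin v))))

  likeNeighbour? : (c′ : Colouring n k) (v : Fin n) → Decidable (λ u → v ~ u × lookup c′ u ≡ lookup c′ v)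
  likeNeighbour? c′ v u = T? (adj v u) ×-dec (lookup c′ u Fin.≟ lookup c′ v)

  -- From happy vertices to feasible candidates

  module _ (c′ : Colouring n k) (ext : Extends c′) where

    given-fits : ∀ x → Fits (colourCode (lookup c′ x)) (given x)
    given-fits x with lookup precolour x | ext x
    ... | just _  | Maybe.just refl = inj₂ refl
    ... | nothing | Maybe.nothing   = inj₁ refl

    -- If some vertex `u` is given the colour of `v` in `c′`, then `candidate u` is this colour, and
    -- `v` and its like neighbours fit it.
    happy⇒feasible : ∀ {v} → Happy c′ v → ∃[ u ] Feasible given v (candidate u)
    happy⇒feasible {v} q≤ with Fin.any? (λ u → given u ℕ.≟ colourCode (lookup c′ v))
    ... | yes (u , g≡) = u , subst (Feasible given v) (sym cand≡)
      (given-fits v , ℕ.≤-trans q≤ (#-mono (likeNeighbour? c′ v) (supporter? given v _)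
        λ w (v~w , same) → v~w , subst (λ i → Fits (colourCode i) (given w)) same (given-fits w)))
      where
      cand≡ : candidate u ≡ colourCode (lookup c′ v)
      cand≡ = trans (positive-≢0 λ g≡0 → ℕ.0≢1+n (trans (sym g≡0) g≡)) g≡
    -- The colour of `v` is given nowhere, so `v` and its like neighbours are uncoloured and fit any
    -- candidate, in particular `candidate v`.
    ... | no ¬given = v , inj₁ (blank v refl) ,
      ℕ.≤-trans q≤ (#-mono (likeNeighbour? c′ v) (supporter? given v _)
        λ w (v~w , same) → v~w , inj₁ (blank w same))
      where
      blank : ∀ w → lookup c′ w ≡ lookup c′ v → given w ≡ 0
      blank w same with given-fits w
      ... | inj₁ g≡0 = g≡0
      ... | inj₂ g≡  = contradiction (w , trans g≡ (cong colourCode same)) ¬given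

  decode : ∀ {m} → 0 < m → m ≤ k → ∃[ i ] colourCode {k} i ≡ m
  decode (s≤s _) m≤k = fromℕ< m≤k , cong suc (Fin.toℕ-fromℕ< m≤k)

  colourCode-injective : ∀ {i j : Fin k} → colourCode i ≡ colourCode j → i ≡ j
  colourCode-injective = Fin.toℕ-injective ∘ ℕ.suc-injective

  -- The output colouring and its approximation ratio

  module _ {c} (valid : Valid c) (tried : ∀ v u → Tried c v u) where

    private
      decoded : ∀ x → ∃[ i ] colourCode {k} i ≡ positive (c x)
      decoded x = decode (positive>0 (c x)) (positive-≤ 0<k (bounded valid x))

    result : Colouring n k
    result = tabulate (proj₁ ∘ decoded)

    result-code : ∀ x → colourCode (lookup result x) ≡ positive (c x)
    result-code x = trans (cong colourCode (lookup∘tabulate (proj₁ ∘ decoded) x)) (proj₂ (decoded x))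

    encode-result : encodeColouring result ≡ tabulate (positive ∘ c)
    encode-result = trans (sym (tabulate-∘ colourCode (proj₁ ∘ decoded)))
                          (tabulate-cong (proj₂ ∘ decoded))

    result-extends : Extends result
    result-extends x with lookup precolour x in eq
    ... | nothing = Maybe.nothing
    ... | just i  = Maybe.just (colourCode-injective (begin
      colourCode (lookup result x) ≡⟨ result-code x ⟩
      positive (c x)               ≡⟨ cong positive (extends valid x g≢0) ⟩
      positive (given x)           ≡⟨ positive-≢0 g≢0 ⟩
      given x                      ≡⟨ cong (maybe′ colourCode 0) eq ⟩
      colourCode i                 ∎))
      where
      open ≡-Reasoning
      g≢0 : given x ≢ 0
      g≢0 g≡0 = ℕ.0≢1+n (trans (sym g≡0) (cong (maybe′ colourCode 0) eq))

    settled⇒happy : ∀ {v} → Settled c v → Happy result v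
    settled⇒happy {v} (c≢0 , q≤) = ℕ.≤-trans q≤
      (#-mono (ally? c v) (likeNeighbour? result v)
        λ u (v~u , c≡) → v~u , colourCode-injective
          (trans (result-code u) (trans (cong positive c≡) (sym (result-code v)))))

    -- The union bound is applied once for each of two layers of closed neighbourhoods, all of size
    -- at most `suc Δ`. The inner centres are the happy vertices of `result`, among which are all
    -- settled ones.
    OPT≤result : OPT I ≤ #happy result * suc Δ * suc Δ
    OPT≤result with OPT-attained I
    ... | c* , ext , attained = begin
      OPT I                          ≡⟨ sym attained ⟩
      #happy c*                      ≤⟨ #-⋃ (happy? c*) reached? near? #-near reach ⟩
      # reached? * suc Δ             ≤⟨ ℕ.*-monoˡ-≤ (suc Δ) (#-⋃ reached? (happy? result) near? #-near λ _ r → r) ⟩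
      #happy result * suc Δ * suc Δ  ∎
      where
      open ℕ.≤-Reasoning

      Reached : Fin n → Set
      Reached x = ∃[ v ] Happy result v × Near v x

      reached? : Decidable Reached
      reached? x = Fin.any? λ v → happy? result v ×-dec near? v x

      reach : ∀ w → Happy c* w → ∃[ x ] Reached x × Near x w
      reach w happy with happy⇒feasible c* ext happy
      ... | u , feasible with tried w u feasible
      -- A settled `w` serves as its own centre in both layers.
      ...   | inj₁ settled = w , (w , settled⇒happy settled , inj₁ refl) , inj₁ refl
      ...   | inj₂ (x , near , c≢g) with charged valid x c≢g
      ...     | v , settled , near′ = x , (v , settled⇒happy settled , near′) , near-sym near

-- The greedy program

pattern input  = 0
pattern colour = 1
pattern vertex = 2
pattern source = 3
pattern index  = 4
pattern tally  = 5
pattern row    = 6  -- the address where the adjacency row of vertex begins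
pattern hue    = 7

positiveᵉ : Expr → Expr
positiveᵉ e = e ⊕ (lit 1 ⊖ e)

-- For e′ > 0 the value is 1 if e is 0 or equal to e′, and 0 otherwise.
fitsᵉ : Expr → Expr → Expr
fitsᵉ e′ e = (lit 1 ⊖ e) ⊕ (lit 1 ⊖ ((e ⊖ e′) ⊕ (e′ ⊖ e)))

adjᵉ : Expr
adjᵉ = input ! (var row ⊕ var index)

-- For operands that are 0 or 1, e ⊕ e′ ⊖ lit 1 is their conjunction.
supportsᵉ feasibleᵉ : Expr
supportsᵉ = (adjᵉ ⊕ fitsᵉ (var hue) (colour ! var index)) ⊖ lit 1
feasibleᵉ =
  (fitsᵉ (var hue) (colour ! var vertex) ⊕ (lit 1 ⊖ (input ! lit 2 ⊖ var tally))) ⊖ lit 1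

COPY COUNT TALLY MARK PAINT TRY SWEEP COMPLETE GREEDY : Program
COPY = FOR index (colour [ var index ]:= input ! (lit 3 ⊕ var index))
COUNT = tally [ lit 0 ]:= var tally ⊕ supportsᵉ
TALLY = tally [ lit 0 ]:= lit 0 ⨾ FOR index COUNT
-- The guard is nonzero exactly for an uncoloured neighbour.
MARK = IF adjᵉ ⊖ (colour ! var index) THEN colour [ var index ]:= var hue ELSE skip
PAINT = FOR index MARK ⨾ colour [ var vertex ]:= var hue
TRY =
  hue [ lit 0 ]:= positiveᵉ (input ! (lit 3 ⊕ var source)) ⨾
  TALLY ⨾
  IF feasibleᵉ THEN PAINT ELSE skip
SWEEP =
  row [ lit 0 ]:= lit 3 ⊕ var input ⨾
  FOR vertex (FOR source TRY ⨾ row [ lit 0 ]:= var row ⊕ var input)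
COMPLETE = FOR index (colour [ var index ]:= positiveᵉ (colour ! var index))
GREEDY = COPY ⨾ SWEEP ⨾ COMPLETE

-- One of the two truncated differences is 0 and the other is the distance of `m` and `i`, which is
-- 0 only if they are equal.
equal-indicator : ∀ m i → 1 ∸ ((m ∸ i) + (i ∸ m)) ≡ (if m ≡ᵇ i then 1 else 0)
equal-indicator zero    zero    = refl
equal-indicator zero    (suc i) = ℕ.0∸n≡0 i
equal-indicator (suc m) zero    = ℕ.0∸n≡0 (m + 0)
equal-indicator (suc m) (suc i) = equal-indicator m i

∧-indicator : ∀ a b → (if a then 1 else 0) + (if b then 1 else 0) ∸ 1 ≡ (if a ∧ b then 1 else 0)
∧-indicator true  true  = refl
∧-indicator true  false = refl
∧-indicator false true  = refl
∧-indicator false false = refl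

Holds : ∀ {n} → Memory → (Fin n → ℕ) → Set
Holds σ c = ∀ x → σ colour (toℕ x) ≡ c x

-- The common shape of `copies`, `completes` and the loop in `paints`: round `y` alters at most
-- entry `y`, so entries below the counter follow `d` and the remaining ones still follow `c`.
recolour : ∀ {n P} σ₀ (c d : Fin n → ℕ) (0∉ : T (unwritten 0 (FOR index P))) (x∉P : T (unwritten index P)) →
           σ₀ input 0 ≡ n →
           (∀ y σ → Frame (FOR index P) σ₀ σ → σ index 0 ≡ toℕ y → σ colour (toℕ y) ≡ c y →
            Runs n P σ λ σ′ → σ′ colour (toℕ y) ≡ d y × ∀ j → j ≢ toℕ y → σ′ colour j ≡ σ colour j) →
           Holds σ₀ c → Runs n (FOR index P) σ₀ λ σ′ → Holds σ′ d
recolour {n} {P} σ₀ c d 0∉ x∉P n≡ step holds =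
  ensuring (for σ₀ Inv 0∉ x∉P n≡ body λ y → (λ ()) , λ _ → holds y)
    λ σ′ _ inv y → proj₁ (inv y) (Fin.toℕ<n y)
  where
  Inv : ℕ → Memory → Set
  Inv j σ = ∀ (y : Fin n) → (toℕ y < j → σ colour (toℕ y) ≡ d y) × (j ≤ toℕ y → σ colour (toℕ y) ≡ c y)

  body : ∀ i σ → Frame (FOR index P) σ₀ σ → σ index 0 ≡ toℕ i → Inv (toℕ i) σ →
         Runs n P σ λ σ′ → Inv (suc (toℕ i)) (σ′ [ index , 0 ↦ suc (σ′ index 0) ])
  body i σ fr i≡ inv = ensuring (step i σ fr i≡ (proj₂ (inv i) ℕ.≤-refl)) λ σ′ _ → λ where
    (new , old) y → (λ y≤i → case y Fin.≟ i of λ where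
                        (yes refl) → new
                        (no  y≢i)  → trans (old (toℕ y) (y≢i ∘ Fin.toℕ-injective))
                          (proj₁ (inv y) (ℕ.≤∧≢⇒< (ℕ.≤-pred y≤i) (y≢i ∘ Fin.toℕ-injective)))) ,
                    (λ i<y → trans (old (toℕ y) (ℕ.<⇒≢ i<y ∘ sym)) (proj₂ (inv y) (ℕ.<⇒≤ i<y)))

overwrites : ∀ {n e} σ y {m} → σ index 0 ≡ y → ⟦ e ⟧ σ ≡ m →
             Runs n (colour [ var index ]:= e) σ λ σ′ →
               σ′ colour y ≡ m × ∀ j → j ≢ y → σ′ colour j ≡ σ colour j
overwrites {e = e} σ y refl e≡m =
  assigns (trans (store-hit σ colour y _) e≡m , λ j → store-miss σ colour (⟦ e ⟧ σ))

-- Correctness of the greedy program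

module _ (I : Instance) where
  open Instance I

  Loaded : Memory → Set
  Loaded σ = ∀ j → σ input j ≡ nth (encode I) j

  rowStart : ℕ → ℕ
  rowStart v = 3 + n + v * n

  copies : ∀ σ₀ → Loaded σ₀ → Runs n COPY σ₀ λ σ → Holds σ (given I)
  copies σ₀ loaded = recolour σ₀ (λ y → σ₀ colour (toℕ y)) (given I) tt tt (loaded 0)
    (λ y σ fr i≡y _ → overwrites σ (toℕ y) i≡y
      (trans (cong (λ i → σ input (3 + i)) i≡y)
        (trans (fr input tt _) (trans (loaded _) (encode-given I y)))))
    (λ _ → refl)

  completes : ∀ σ₀ c → Loaded σ₀ → Holds σ₀ c → Runs n COMPLETE σ₀ λ σ → Holds σ (positive ∘ c)
  completes σ₀ c loaded = recolour σ₀ c (positive ∘ c) tt tt (loaded 0)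
    λ y σ fr i≡y held → overwrites σ (toℕ y) i≡y
      (cong positive (trans (cong (σ colour) i≡y) held))

  -- As `i` is positive, `m` cannot be both 0 and `i`, so at most one of the two summands is 1.
  fits-value : ∀ {i} m → 0 < i → (1 ∸ m) + (1 ∸ ((m ∸ i) + (i ∸ m))) ≡ indicator (fits? I i m)
  fits-value {suc i} zero    _ = cong suc (ℕ.0∸n≡0 i)
  fits-value {suc i} (suc m) _ =
    trans (cong (_+ (1 ∸ ((m ∸ i) + (i ∸ m)))) (ℕ.0∸n≡0 m)) (equal-indicator m i)

  adj-value : ∀ σ v w → Loaded σ → σ row 0 ≡ rowStart (toℕ v) → σ index 0 ≡ toℕ w →
              ⟦ adjᵉ ⟧ σ ≡ (if adj v w then 1 else 0)
  adj-value σ v w loaded row≡ w≡ =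
    trans (cong₂ (λ r i → σ input (r + i)) row≡ w≡) (trans (loaded _) (encode-adj I v w))

  fits-at : ∀ σ {i m x} → σ hue 0 ≡ i → σ colour x ≡ m → 0 < i →
            ⟦ fitsᵉ (var hue) (colour ! lit x) ⟧ σ ≡ indicator (fits? I i m)
  fits-at σ {m = m} refl refl 0<i = fits-value m 0<i

  module _ {c : Codes I} {v : Fin n} {i : ℕ} (0<i : 0 < i) (σ₀ : Memory) (loaded : Loaded σ₀)
    (holds : Holds σ₀ c) (row≡ : σ₀ row 0 ≡ rowStart (toℕ v)) (hue≡ : σ₀ hue 0 ≡ i) where

    tallies : Runs n TALLY σ₀ λ σ → σ tally 0 ≡ # (supporter? I c v i)
    tallies = assigns refl then λ σ₁ fr₁ tally≡0 →
      ensuring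
        (for σ₁ (λ j σ → σ tally 0 ≡ #below (supporter? I c v i) j) tt tt
          (trans (fr₁ input tt 0) (loaded 0))
          (λ w σ fr w≡ inv → assigns (trans
            (cong₂ _+_ inv (counted w σ
              (λ j → trans (fr input tt j) (trans (fr₁ input tt j) (loaded j)))
              (λ x → trans (fr colour tt (toℕ x)) (trans (fr₁ colour tt (toℕ x)) (holds x)))
              (trans (fr row tt 0) (trans (fr₁ row tt 0) row≡))
              (trans (fr hue tt 0) (trans (fr₁ hue tt 0) hue≡))
              w≡))
            (sym (#below-suc (supporter? I c v i) w))))
          tally≡0)
        λ _ _ inv → trans inv (#below-all (supporter? I c v i))
      where
      counted : ∀ w σ → Loaded σ → Holds σ c → σ row 0 ≡ rowStart (toℕ v) → σ hue 0 ≡ i →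
                σ index 0 ≡ toℕ w →
                ⟦ supportsᵉ ⟧ σ ≡ indicator (supporter? I c v i w)
      counted w σ loaded holds row≡ hue≡ w≡ = trans
        (cong₂ (λ a f → a + f ∸ 1)
          (adj-value σ v w loaded row≡ w≡)
          (fits-at σ hue≡ (trans (cong (σ colour) w≡) (holds w)) 0<i))
        (∧-indicator (adj v w) (does (fits? I i (c w))))

    -- The loop handles the neighbours of `v`, giving `spread`, and the final assignment handles
    -- `v`. The latter is unconditional, which is harmless: by `Fits` the old code of `v` is 0 or
    -- already `i`.
    paints : σ₀ vertex 0 ≡ toℕ v → Fits I i (c v) → Runs n PAINT σ₀ λ σ → Holds σ (paint I c v i)
    paints vertex≡ fits =
      recolour σ₀ c spread tt tt (loaded 0) step holds then λ σ₁ fr₁ holds₁ →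
      assigns λ x → stored σ₁ fr₁ holds₁ x
      where
      spread : Codes I
      spread x = if does (T? (adj v x) ×-dec (c x ℕ.≟ 0)) then i else c x

      step : ∀ y σ → Frame (FOR index MARK) σ₀ σ →
             σ index 0 ≡ toℕ y → σ colour (toℕ y) ≡ c y →
             Runs n MARK σ λ σ′ → σ′ colour (toℕ y) ≡ spread y × ∀ j → j ≢ toℕ y → σ′ colour j ≡ σ colour j
      step y σ fr y≡ held = branches
        (λ ≢0 → overwrites σ (toℕ y) y≡ (trans (trans (fr hue tt 0) hue≡) (sym (filled (≢0 ∘ trans value)))))
        (λ ≡0 → skips (trans held (sym (kept (trans (sym value) ≡0))) , λ _ _ → refl))
        where
        value : ⟦ adjᵉ ⊖ (colour ! var index) ⟧ σ ≡ (if adj v y then 1 else 0) ∸ c y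
        value = cong₂ _∸_
          (adj-value σ v y (λ j → trans (fr input tt j) (loaded j)) (trans (fr row tt 0) row≡) y≡)
          (trans (cong (σ colour) y≡) held)

        filled : (if adj v y then 1 else 0) ∸ c y ≢ 0 → spread y ≡ i
        filled ≢0 with adj v y | c y
        ... | true  | zero  = refl
        ... | true  | suc m = contradiction (ℕ.0∸n≡0 m) ≢0
        ... | false | m     = contradiction (ℕ.0∸n≡0 m) ≢0

        kept : (if adj v y then 1 else 0) ∸ c y ≡ 0 → spread y ≡ c y
        kept ≡0 with adj v y | c y
        ... | true  | suc m = refl
        ... | false | m     = refl

      spread≡paint : ∀ x → x ≢ v → spread x ≡ paint I c v i x
      spread≡paint x x≢v with T? (adj v x) ×-dec (c x ℕ.≟ 0)
      ... | yes (v~x , c≡0) = trans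
        (cong (λ b → if b then i else c x) (dec-true (T? (adj v x) ×-dec (c x ℕ.≟ 0)) (v~x , c≡0)))
        (sym (paint-new I c v i (inj₂ v~x) c≡0))
      ... | no ¬new = trans
        (cong (λ b → if b then i else c x) (dec-false (T? (adj v x) ×-dec (c x ℕ.≟ 0)) ¬new))
        (sym (paint-old I c v i λ where
          (inj₁ x≡v , _)   → x≢v x≡v
          (inj₂ v~x , c≡0) → ¬new (v~x , c≡0)))

      stored : ∀ σ₁ → Frame (FOR index MARK) σ₀ σ₁ →
               Holds σ₁ spread → Holds (σ₁ [ colour , σ₁ vertex 0 ↦ σ₁ hue 0 ]) (paint I c v i)
      stored σ₁ fr₁ holds₁ x = case x Fin.≟ v of λ where
        (yes refl) → trans
          (cong (λ j → (σ₁ [ colour , j ↦ σ₁ hue 0 ]) colour (toℕ v)) (trans (fr₁ vertex tt 0) vertex≡))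
          (trans (store-hit σ₁ colour (toℕ v) (σ₁ hue 0))
            (trans (trans (fr₁ hue tt 0) hue≡) (sym (paint-fits I c v i (inj₁ refl) fits))))
        (no x≢v) → trans
          (store-miss σ₁ colour (σ₁ hue 0) λ x≡ →
            x≢v (Fin.toℕ-injective (trans x≡ (trans (fr₁ vertex tt 0) vertex≡))))
          (trans (holds₁ x) (spread≡paint x x≢v))

  -- Here `m` stands for `q ∸ tally`, which is 0 exactly if there are enough supporters.
  indicator-∸ : ∀ {A : Set} (a? : Dec A) m → A → m ≡ 0 → indicator a? + (1 ∸ m) ∸ 1 ≡ 1
  indicator-∸ (yes _) m a refl = refl
  indicator-∸ (no ¬a) m a refl = contradiction a ¬a

  indicator-∸⁻ : ∀ {A : Set} (a? : Dec A) m → indicator a? + (1 ∸ m) ∸ 1 ≢ 0 → A × m ≡ 0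
  indicator-∸⁻ (yes a) zero    ≢0 = a , refl
  indicator-∸⁻ (yes _) (suc m) ≢0 = contradiction (ℕ.0∸n≡0 m) ≢0
  indicator-∸⁻ (no  _) zero    ≢0 = contradiction refl ≢0
  indicator-∸⁻ (no  _) (suc m) ≢0 = contradiction (cong (_∸ 1) (ℕ.0∸n≡0 m)) ≢0

  tries : ∀ {c v u} σ₀ → Loaded σ₀ → Holds σ₀ c → Valid I c →
          σ₀ vertex 0 ≡ toℕ v → σ₀ source 0 ≡ toℕ u → σ₀ row 0 ≡ rowStart (toℕ v) →
          Runs n TRY σ₀ λ σ → ∃[ d ] Holds σ d × Valid I d × _⊑_ I c d × Tried I d v u
  tries {c} {v} {u} σ₀ loaded holds valid vertex≡ source≡ row≡ =
    assigns {Φ = λ σ → σ hue 0 ≡ i}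
      (cong positive (trans (cong (λ j → σ₀ input (3 + j)) source≡) (trans (loaded _) (encode-given I u))))
    then λ σ₁ fr₁ hue≡ →
    tallies 0<i σ₁ (λ j → trans (fr₁ input tt j) (loaded j)) (λ x → trans (fr₁ colour tt (toℕ x)) (holds x))
      (trans (fr₁ row tt 0) row≡) hue≡
    then λ σ₂ fr₂ tally≡ →
    -- `unwritten` looks only at the array assigned to, so `lit 0` can stand for the expression
    -- stored in `hue`.
    let fr : ∀ a → T (unwritten a (hue [ lit 0 ]:= lit 0)) → T (unwritten a TALLY) → ∀ j → σ₂ a j ≡ σ₀ a j
        fr a a∉ a∉′ j = trans (fr₂ a a∉′ j) (fr₁ a a∉ j)
        loaded₂ : Loaded σ₂
        loaded₂ j = trans (fr input tt tt j) (loaded j)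
        holds₂ : Holds σ₂ c
        holds₂ x = trans (fr colour tt tt (toℕ x)) (holds x)
        hue₂≡ : σ₂ hue 0 ≡ i
        hue₂≡ = trans (fr₂ hue tt 0) hue≡
        vertex₂≡ : σ₂ vertex 0 ≡ toℕ v
        vertex₂≡ = trans (fr vertex tt tt 0) vertex≡
        test≡ : ⟦ feasibleᵉ ⟧ σ₂ ≡ indicator (fits? I i (c v)) + (1 ∸ (q ∸ # (supporter? I c v i))) ∸ 1
        test≡ = cong₂ (λ f m → f + (1 ∸ m) ∸ 1)
          (fits-at σ₂ hue₂≡ (trans (cong (σ₂ colour) vertex₂≡) (holds₂ v)) 0<i)
          (cong₂ _∸_ (loaded₂ 2) tally≡)
    in branches
      (λ ≢0 → case indicator-∸⁻ (fits? I i (c v)) _ (≢0 ∘ trans test≡) of λ where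
        (fits , q∸≡0) →
          let feasible : Feasible I c v i
              feasible = fits , ℕ.m∸n≡0⇒m≤n q∸≡0
          in ensuring (paints 0<i σ₂ loaded₂ holds₂ (trans (fr row tt tt 0) row≡) hue₂≡ vertex₂≡ fits)
            λ _ _ holds′ → paint I c v i , holds′ , paint-valid I 0<i (candidate-≤ I u) feasible valid ,
              ⊑-paint I c v i , λ _ → inj₁ (paint-settled I 0<i feasible))
      (λ ≡0 → skips (c , holds₂ , valid , (λ _ _ → refl) , infeasible-tried I λ where
        (fits , q≤) → ℕ.1+n≢0 (trans (sym (indicator-∸ (fits? I i (c v)) _ fits (ℕ.m≤n⇒m∸n≡0 q≤)))
                                     (trans (sym test≡) ≡0))))
    where
    i : ℕ
    i = candidate I u
    0<i : 0 < i
    0<i = positive>0 (given I u)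

  TriedBelow : Codes I → ℕ → Set
  TriedBelow c j = ∀ w → toℕ w < j → ∀ u → Tried I c w u

  -- The colouring only grows during the loop, so by `tried-mono` the earlier pairs stay tried.
  tries-all : ∀ {c v} σ₀ → Loaded σ₀ → Holds σ₀ c → Valid I c → TriedBelow c (toℕ v) →
              σ₀ vertex 0 ≡ toℕ v → σ₀ row 0 ≡ rowStart (toℕ v) →
              Runs n (FOR source TRY) σ₀ λ σ → ∃[ d ] Holds σ d × Valid I d × TriedBelow d (suc (toℕ v))
  tries-all {c} {v} σ₀ loaded holds valid below vertex≡ row≡ =
    ensuring (for σ₀ Inv tt tt (loaded 0) body (c , holds , valid , below , λ _ ()))
      λ where
        _ _ (d , holds′ , valid′ , below′ , here) → d , holds′ , valid′ , λ w w≤v → case w Fin.≟ v of λ where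
          (yes refl) u → here u (Fin.toℕ<n u)
          (no w≢v)     → below′ w (ℕ.≤∧≢⇒< (ℕ.≤-pred w≤v) (w≢v ∘ Fin.toℕ-injective))
    where
    Inv : ℕ → Memory → Set
    Inv j σ = ∃[ d ] Holds σ d × Valid I d × TriedBelow d (toℕ v) × (∀ u → toℕ u < j → Tried I d v u)

    body : ∀ u σ → Frame (FOR source TRY) σ₀ σ → σ source 0 ≡ toℕ u → Inv (toℕ u) σ →
           Runs n TRY σ λ σ′ → Inv (suc (toℕ u)) (σ′ [ source , 0 ↦ suc (σ′ source 0) ])
    body u σ fr u≡ (c , holds , valid , below , here) =
      ensuring (tries {c} {v} {u} σ (λ j → trans (fr input tt j) (loaded j)) holds valid
                 (trans (fr vertex tt 0) vertex≡) u≡ (trans (fr row tt 0) row≡))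
        λ where
          _ _ (d , holds′ , valid′ , c⊑d , tried) →
            let keep : ∀ {w u′} → Tried I c w u′ → Tried I d w u′
                keep = tried-mono I (Valid.extends valid) c⊑d
            in d , holds′ , valid′ , (λ w w<v u′ → keep (below w w<v u′)) ,
               λ u′ u′≤u → case u′ Fin.≟ u of λ where
                 (yes refl) → tried
                 (no u′≢u)  → keep (here u′ (ℕ.≤∧≢⇒< (ℕ.≤-pred u′≤u) (u′≢u ∘ Fin.toℕ-injective)))

  sweeps : ∀ σ₀ → Loaded σ₀ → Holds σ₀ (given I) →
           Runs n SWEEP σ₀ λ σ → ∃[ d ] Holds σ d × Valid I d × ∀ v u → Tried I d v u
  sweeps σ₀ loaded holds =
    assigns {Φ = λ σ → σ row 0 ≡ rowStart 0}
      (trans (cong (λ m → 3 + m) (loaded 0)) (sym (ℕ.+-identityʳ (3 + n))))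
    then λ σ₁ fr₁ row≡ →
    ensuring (for σ₁ Inv tt tt (trans (fr₁ input tt 0) (loaded 0))
      (λ where
        v σ fr v≡ (row≡ , c , holds , valid , below) →
          let loaded′ : Loaded σ
              loaded′ j = trans (fr input tt j) (trans (fr₁ input tt j) (loaded j))
          in tries-all {c} {v} σ loaded′ holds valid below v≡ row≡
          then λ σ′ fr′ reached →
          assigns (trans (cong₂ _+_ (trans (fr′ row tt 0) row≡) (trans (fr′ input tt 0) (loaded′ 0)))
                         (trans (ℕ.+-assoc (3 + n) (toℕ v * n) n) (cong (λ m → 3 + n + m) (ℕ.+-comm (toℕ v * n) n)))
                  , reached))
      (row≡ , given I , (λ x → trans (fr₁ colour tt (toℕ x)) (holds x)) , given-valid I , λ _ ()))
      λ where
        _ _ (_ , d , holds′ , valid , below) → d , holds′ , valid , λ v → below v (Fin.toℕ<n v)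
    where
    -- Without multiplication the row address cannot be computed directly; it is kept in the
    -- invariant and advanced by `n` after each vertex.
    Inv : ℕ → Memory → Set
    Inv j σ = σ row 0 ≡ rowStart j × ∃[ d ] Holds σ d × Valid I d × TriedBelow d j

  -- With the program as a parameter, its `time` and `depth` stay symbolic in
  -- `exhausts⇒approximates`.
  Exhausts : Program → Set
  Exhausts P = Runs n P (load (encode I)) λ σ →
    ∃[ c ] Holds σ (positive ∘ c) × Valid I c × ∀ v u → Tried I c v u

  greedy : Exhausts GREEDY
  greedy =
    copies (load (encode I)) (λ _ → refl)
    then λ σ₁ fr₁ holds₁ →
    sweeps σ₁ (fr₁ input tt) holds₁
    then λ where
      σ₂ fr₂ (c , holds₂ , valid , tried) →
        ensuring (completes σ₂ c (λ j → trans (fr₂ input tt j) (fr₁ input tt j)) holds₂)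
          λ _ _ holds₃ → c , holds₃ , valid , tried

-- Approximation ratio and polynomial time bound

exhausts⇒approximates : ∀ P (I : Instance) .{{Δ≢0 : NonZero (Instance.Δ I)}} → Exhausts I P →
  ∃[ c′ ]
  (P on encode I yields encodeColouring c′ within (time 0 P * bitSize (encode I) ^ depth P)
  × Instance.Extends I c′
  × (+ 1 / 4) ℚ.* _/_ (+ OPT I) (Instance.Δ I ^ 3) {{m^n≢0 (Instance.Δ I) 3}} ℚ.≤ + Instance.#happy I c′ / 1)
exhausts⇒approximates P I (runs {σ} {t} D t≤ (c , holds , valid , tried)) =
  c′ ,
  (σ , t , D , trans (tabulate-cong holds) (sym (encode-result I valid tried)) , fast) ,
  result-extends I valid tried ,
  ¼*o/d≤h (OPT I) (Δ ^ 3) (#happy c′) {{m^n≢0 Δ 3}} (begin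
    OPT I                        ≤⟨ OPT≤result I valid tried ⟩
    #happy c′ * suc Δ * suc Δ    ≡⟨ ℕ.*-assoc (#happy c′) (suc Δ) (suc Δ) ⟩
    #happy c′ * (suc Δ * suc Δ)  ≤⟨ ℕ.*-monoʳ-≤ (#happy c′) ([1+d]²≤4d³ Δ) ⟩
    #happy c′ * (4 * Δ ^ 3)      ∎)
  where
  open Instance I
  open ℕ.≤-Reasoning
  c′ : Colouring n k
  c′ = result I valid tried
  fast : t ≤ time 0 P * bitSize (encode I) ^ depth P
  -- The bound `n<bitSize` is strict, so the base `suc n` is at most the bit size.
  fast = ℕ.≤-trans t≤ (ℕ.≤-trans (time-polynomial n P)
    (ℕ.*-monoʳ-≤ (time 0 P) (ℕ.^-monoˡ-≤ (depth P) (n<bitSize I))))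

theoremC2 : ∃[ α ] 0ℚ ℚ.< α ×
    (∃[ P ] ∃[ a ] ∃[ d ]
    ((I : Instance) .{{Δ≢0 : NonZero (Instance.Δ I)}} →
    ∃[ c′ ]
    (P on encode I yields encodeColouring c′ within (a * bitSize (encode I) ^ d)
    × Instance.Extends I c′
    × α ℚ.* _/_ (+ OPT I) (Instance.Δ I ^ 3) {{m^n≢0 (Instance.Δ I) 3}} ℚ.≤ + Instance.#happy I c′ / 1)))
theoremC2 = + 1 / 4 , ℚ.*<* (ℤ.+<+ (s≤s z≤n)) ,
  GREEDY , time 0 GREEDY , depth GREEDY ,
  λ I → exhausts⇒approximates GREEDY I (greedy I)
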